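{- Let $r$ and $m$ be positive integers. Then there exist infinitely many primes $p$ such that $pm$ is a Schemmel nontotient number of order $r$, i.e. $pm \notin \{S_r(x) : x \in \mathbb{N}\}$.
   Context: For a positive integer $r$, the Schemmel totient function $S_r$ is the multiplicative arithmetic function determined by $S_r(p^{\alpha}) = 0$ if $p \le r$ and $S_r(p^{\alpha}) = p^{\alpha-1}(p-r)$ if $p > r$, for all primes $p$ and positive integers $\alpha$ (and $S_r(1)=1$). A Schemmel nontotient number of order $r$ is a positive integer not in the range of $S_r$. -}

module Defs where

open import Data.Nat using (ℕ; _*_; _∸_; _^_; _≤_; _>_; suc)
open import Data.Nat.Primality using (Prime)
open import Data.Nat.Coprimality using (Coprime)
open import Data.Product using (_×_)
open import Data.Empty using (⊥)
open import Relation.Binary.PropositionalEquality using (_≡_)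

-- f is the Schemmel totient function S_r on the positive integers:
-- S_r(1) = 1, S_r is multiplicative, and on prime powers p^α (α ≥ 1)
-- S_r(p^α) = 0 if p ≤ r, and p^(α-1) (p - r) if p > r.
-- These properties determine S_r uniquely on positive integers
-- (the value at 0 is irrelevant and left unconstrained).
record IsSchemmelTotient (r : ℕ) (f : ℕ → ℕ) : Set where
  field
    one           : f 1 ≡ 1
    multiplicative : ∀ a b → 1 ≤ a → 1 ≤ b → Coprime a b → f (a * b) ≡ f a * f b
    small-prime   : ∀ p α → Prime p → p ≤ r → f (p ^ suc α) ≡ 0
    large-prime   : ∀ p α → Prime p → p > r → f (p ^ suc α) ≡ p ^ α * (p ∸ r)

SchemmelNontotient : (ℕ → ℕ) → ℕ → Set
SchemmelNontotient f n = (1 ≤ n) × (∀ x → 1 ≤ x → f x ≡ n → ⊥)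

{-# OPTIONS --safe #-}
module Submission where

-- Let x be a factorial and n = (2x)^K. For 2 ≤ j ≤ K + 1 put n_j = (2x/j)^K = n / j^K and factor
-- A = x^n - 1 as B_j G_j with B_j = x^(n_j) - 1. Since G_j ≡ j^K mod B_j and A is prime to x, B_j and
-- G_j are coprime. The exponent K makes the n_j so small that the product of the B_j is less than A;
-- A divides that product times D = gcd of the G_j, so D > 1. Let p be a prime factor of D. Modulo p
-- the element x^(n_j) is not 1 and its order divides j^K and p - 1, hence gcd(j, p - 1) > 1.
-- Now suppose S_r(y) = pm with p > m + r. Either p² ∣ y, and then p - r divides m, which is too small,
-- or y has a prime factor q = pd + r with d ∣ m; but q = (p - 1)d + (d + r) is divisible by
-- gcd(d + r, p - 1), which is neither 1 nor q.

open import Defs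
open import Data.Nat
open import Data.Nat.Properties
open import Data.Nat.Divisibility
open import Data.Nat.Primality
open import Data.Nat.Coprimality as Coprimality using (Coprime; coprime-Bézout; coprime-divisor; gcd≡1⇒coprime)
open import Data.Nat.GCD
open import Data.Nat.Combinatorics using (_C_; nCn≡1; nC1≡n; nCk+nC[k+1]≡[n+1]C[k+1])
open import Data.Nat.DivMod using (m/n*n≡m)
open import Data.Nat.Induction using (<-rec)
open import Data.Nat.Tactic.RingSolver using (solve-∀)
open import Data.Nat.Primality.Factorisation using (factorise)
open import Data.Nat.ListAction using (product)
open import Data.List using ([]; _∷_)
open import Data.List.Relation.Unary.All using (_∷_)
open import Data.Fin as Fin using (Fin; toℕ; inject₁)
open import Data.Fin.Properties using (toℕ-inject₁; toℕ<n; toℕ-fromℕ)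
open import Data.Product using (Σ; ∃-syntax; _×_; _,_; proj₁; proj₂)
open import Data.Sum using (_⊎_; inj₁; inj₂)
open import Data.Empty using (⊥)
open import Function using (_∘_; it)
open import Relation.Nullary using (¬_; yes; no; contradiction)
open import Relation.Binary.PropositionalEquality
import Algebra.Properties.CommutativeSemiring.Binomial +-*-commutativeSemiring as Binomial
open import Algebra.Properties.Semiring.Exp +-*-semiring using () renaming (_^_ to _^ᴿ_)
open import Algebra.Properties.Monoid.Sum +-0-monoid using (sum; sum-init-last)
open import Algebra.Definitions.RawMonoid +-0-rawMonoid using () renaming (_×_ to _×ᴿ_)

-- Binomial coefficients and Fermat's little theorem.

-- Absorption identity, from Pascal's rule by induction on `n`. With p = `suc n` it exposes a factor
-- p, from which Euclid's lemma extracts `p ∣ p C k`.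
[k+1]*[n+1]C[k+1]≡[n+1]*nCk : ∀ n k → suc k * (suc n C suc k) ≡ suc n * (n C k)
[k+1]*[n+1]C[k+1]≡[n+1]*nCk zero zero = refl
[k+1]*[n+1]C[k+1]≡[n+1]*nCk zero (suc k) = *-zeroʳ k
[k+1]*[n+1]C[k+1]≡[n+1]*nCk (suc n) zero = begin
  1 * (2+ n C 1)  ≡⟨ *-identityˡ _ ⟩
  2+ n C 1        ≡⟨ nC1≡n (2+ n) ⟩
  2+ n            ≡⟨ *-identityʳ _ ⟨
  2+ n * 1        ∎
  where open ≡-Reasoning
[k+1]*[n+1]C[k+1]≡[n+1]*nCk (suc n) (suc k) = begin
  2+ k * (2+ n C 2+ k)
    ≡⟨ cong (2+ k *_) (nCk+nC[k+1]≡[n+1]C[k+1] (suc n) (suc k)) ⟨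
  2+ k * (u + (suc n C 2+ k))
    ≡⟨ *-distribˡ-+ (2+ k) u _ ⟩
  u + suc k * u + 2+ k * (suc n C 2+ k)
    ≡⟨ cong₂ (λ s t → u + s + t) ([k+1]*[n+1]C[k+1]≡[n+1]*nCk n k) ([k+1]*[n+1]C[k+1]≡[n+1]*nCk n (suc k)) ⟩
  u + suc n * (n C k) + suc n * (n C suc k)
    ≡⟨ +-assoc u _ _ ⟩
  u + (suc n * (n C k) + suc n * (n C suc k))
    ≡⟨ cong (u +_) (*-distribˡ-+ (suc n) (n C k) (n C suc k)) ⟨
  u + suc n * ((n C k) + (n C suc k))
    ≡⟨ cong (λ t → u + suc n * t) (nCk+nC[k+1]≡[n+1]C[k+1] n k) ⟩
  2+ n * u ∎
  where
  open ≡-Reasoning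
  u = suc n C suc k

prime∣pCk : ∀ {p k} → Prime p → 0 < k → k < p → p ∣ p C k
prime∣pCk {suc n} {suc k} pr _ k<p with euclidsLemma (suc k) (suc n C suc k) pr
  (subst (suc n ∣_) (sym ([k+1]*[n+1]C[k+1]≡[n+1]*nCk n k)) (m∣m*n (n C k)))
... | inj₁ p∣k = contradiction p∣k (>⇒∤ k<p)
... | inj₂ p∣C = p∣C

∣-sum : ∀ {d n} (f : Fin n → ℕ) → (∀ i → d ∣ f i) → d ∣ sum f
∣-sum {n = zero}  f h = _ ∣0
∣-sum {n = suc n} f h = ∣m∣n⇒∣m+n (h Fin.zero) (∣-sum (f ∘ Fin.suc) (h ∘ Fin.suc))

×ᴿ≡* : ∀ n a → n ×ᴿ a ≡ n * a
×ᴿ≡* zero    a = refl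
×ᴿ≡* (suc n) a = cong (a +_) (×ᴿ≡* n a)

^ᴿ≡^ : ∀ a n → a ^ᴿ n ≡ a ^ n
^ᴿ≡^ a zero    = refl
^ᴿ≡^ a (suc n) = cong (a *_) (^ᴿ≡^ a n)

-- Every binomial term between the two ends is divisible by `p`. The congruence is stated with an
-- explicit multiple of `p`, which avoids subtraction.
frobenius : ∀ {p} → Prime p → ∀ a → ∃[ c ] (1 + a) ^ p ≡ a ^ p + (p * c + 1)
frobenius {2+ n} pr a = c , (begin
  (1 + a) ^ p       ≡⟨ ^ᴿ≡^ (1 + a) p ⟨
  (1 + a) ^ᴿ p      ≡⟨ Binomial.theorem p 1 a ⟩
  term Fin.zero + sum (term ∘ Fin.suc)
    ≡⟨ cong₂ _+_ first (trans (sum-init-last (term ∘ Fin.suc)) (cong₂ _+_ middle last)) ⟩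
  a ^ p + (p * c + 1) ∎)
  where
  open ≡-Reasoning
  p = 2+ n
  term = Binomial.binomialTerm 1 a p
  term≡ : ∀ i → term i ≡ (p C toℕ i) * a ^ (p ∸ toℕ i)
  term≡ i = begin
    term i ≡⟨ ×ᴿ≡* (p C toℕ i) _ ⟩
    (p C toℕ i) * (1 ^ᴿ toℕ i * a ^ᴿ (p ∸ toℕ i))
      ≡⟨ cong (λ t → (p C toℕ i) * t) (cong₂ _*_ (trans (^ᴿ≡^ 1 (toℕ i)) (^-zeroˡ (toℕ i))) (^ᴿ≡^ a (p ∸ toℕ i))) ⟩
    (p C toℕ i) * (1 * a ^ (p ∸ toℕ i))
      ≡⟨ cong ((p C toℕ i) *_) (*-identityˡ _) ⟩
    (p C toℕ i) * a ^ (p ∸ toℕ i) ∎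
  first : term Fin.zero ≡ a ^ p
  first = trans (term≡ Fin.zero) (*-identityˡ (a ^ p))
  last : term (Fin.suc (Fin.fromℕ (suc n))) ≡ 1
  last = begin
    term (Fin.fromℕ p) ≡⟨ term≡ (Fin.fromℕ p) ⟩
    (p C toℕ (Fin.fromℕ p)) * a ^ (p ∸ toℕ (Fin.fromℕ p))
      ≡⟨ cong (λ t → (p C t) * a ^ (p ∸ t)) (toℕ-fromℕ p) ⟩
    (p C p) * a ^ (p ∸ p) ≡⟨ cong₂ (λ s t → s * a ^ t) (nCn≡1 p) (n∸n≡0 p) ⟩
    1 ∎
  inner : Fin (suc n) → ℕ
  inner = term ∘ Fin.suc ∘ inject₁
  inner∣ : ∀ i → p ∣ inner i
  inner∣ i = subst (p ∣_) (sym (term≡ (Fin.suc (inject₁ i))))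
    (∣m⇒∣m*n _ (prime∣pCk pr z<s
      (s<s (subst (_< suc n) (sym (toℕ-inject₁ i)) (toℕ<n i)))))
  p∣middle = ∣-sum inner inner∣
  c = quotient p∣middle
  middle : sum inner ≡ p * c
  middle = m∣n⇒n≡m*quotient p∣middle

a^p≡a : ∀ {p} → Prime p → ∀ a → ∃[ c ] a ^ p ≡ a + p * c
a^p≡a {2+ n} pr zero = 0 , sym (*-zeroʳ n)
a^p≡a {p} pr (suc a) with frobenius pr a | a^p≡a pr a
... | c , eq | d , eq′ = d + c , trans eq (trans (cong (_+ (p * c + 1)) eq′) (lem a p c d))
  where
  lem : ∀ a p c d → a + p * d + (p * c + 1) ≡ suc (a + p * (d + c))
  lem = solve-∀

fermat : ∀ {p a} → Prime p → p ∤ a → p ∣ pred (a ^ pred p)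
fermat {p} {zero} _ p∤0 = contradiction (p ∣0) p∤0
fermat {suc n} {a@(suc _)} pr p∤a with a ^ n in eq | a^p≡a pr a
-- `pred zero` is `0`, so this case, impossible for positive `a`, holds without being refuted.
... | zero  | _ = suc n ∣0
... | suc z | c , eq′ with euclidsLemma a z pr (divides c (+-cancelˡ-≡ a _ _ (begin
  a + a * z        ≡⟨ *-suc a z ⟨
  a * suc z        ≡⟨ eq′ ⟩
  a + suc n * c    ≡⟨ cong (a +_) (*-comm (suc n) c) ⟩
  a + c * suc n    ∎)))
  where open ≡-Reasoning
... | inj₁ p∣a = contradiction p∣a p∤a
... | inj₂ p∣z = p∣z

-- Geometric sums and orders of elements modulo `p`.

-- The sum 1 + y + ... + y^(k-1) for y = `suc b`, in Horner form: the cofactor of `b` in y^k - 1,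
-- defined without division.
geometric : ℕ → ℕ → ℕ
geometric b zero    = 0
geometric b (suc k) = suc (suc b * geometric b k)

suc^≡1+*geometric : ∀ b k → suc b ^ k ≡ suc (b * geometric b k)
suc^≡1+*geometric b zero = cong suc (sym (*-zeroʳ b))
suc^≡1+*geometric b (suc k) = trans (cong (suc b *_) (suc^≡1+*geometric b k)) (lem b (geometric b k))
  where
  lem : ∀ b g → suc b * suc (b * g) ≡ suc (b * suc (suc b * g))
  lem = solve-∀

-- Every power of `suc b` is 1 modulo `b`, so the `k` summands add up to `k` modulo `b`.
geometric≡ : ∀ b k → ∃[ t ] geometric b k ≡ b * t + k
geometric≡ b zero = 0 , sym (trans (+-identityʳ _) (*-zeroʳ b))
geometric≡ b (suc k) with geometric≡ b k
... | t , eq = t + b * t + k , trans (cong (λ g → suc (suc b * g)) eq) (lem b t k)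
  where
  lem : ∀ b t k → suc (suc b * (b * t + k)) ≡ b * (t + b * t + k) + suc k
  lem = solve-∀

∣geometric⇒∣ : ∀ {p b} k → p ∣ b → p ∣ geometric b k → p ∣ k
∣geometric⇒∣ {p} {b} k p∣b p∣g with geometric≡ b k
... | t , eq = ∣m+n∣m⇒∣n (subst (p ∣_) eq p∣g) (∣m⇒∣m*n t p∣b)

∣pred-^ : ∀ {p b s} k → p ∣ pred (suc b ^ s) → ∃[ c ] suc b ^ (k * s) ≡ suc (p * c)
∣pred-^ {p} {b} {s} k p∣ with suc b ^ s in eq | m^n≢0 (suc b) s
... | suc z | _ = _ , (begin
  suc b ^ (k * s)                    ≡⟨ cong (suc b ^_) (*-comm k s) ⟩
  suc b ^ (s * k)                    ≡⟨ ^-*-assoc (suc b) s k ⟨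
  (suc b ^ s) ^ k                    ≡⟨ cong (_^ k) eq ⟩
  suc z ^ k                          ≡⟨ suc^≡1+*geometric z k ⟩
  suc (z * geometric z k)            ≡⟨ cong suc (m∣n⇒n≡m*quotient (∣m⇒∣m*n (geometric z k) p∣)) ⟩
  suc (p * _) ∎)
  where open ≡-Reasoning

-- The equation gives y * (y^t)^v = (y^s)^u; modulo `p` both bracketed powers are 1, hence so is y.
bézout⇒∣pred : ∀ {p} y .{{_ : NonZero y}} {s t} u v → 1 + v * t ≡ u * s →
  p ∣ pred (y ^ s) → p ∣ pred (y ^ t) → p ∣ pred y
bézout⇒∣pred {p} (suc b) {s} {t} u v eq ps pt with ∣pred-^ {s = s} u ps | ∣pred-^ {s = t} v pt
... | α , eα | β , eβ = ∣m+n∣m⇒∣n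
  (divides α (trans (suc-injective (begin
    suc (p * (β * suc b) + b)  ≡⟨ lem p β b ⟩
    suc b * suc (p * β)        ≡⟨ cong (suc b *_) eβ ⟨
    suc b ^ (1 + v * t)        ≡⟨ cong (suc b ^_) eq ⟩
    suc b ^ (u * s)            ≡⟨ eα ⟩
    suc (p * α)                ∎)) (*-comm p α)))
  (m∣m*n (β * suc b))
  where
  open ≡-Reasoning
  lem : ∀ p β b → suc (p * (β * suc b) + b) ≡ suc b * suc (p * β)
  lem = solve-∀

-- The order of `y` modulo `p` would divide both exponents. Bézout replaces that notion; its two
-- cases are symmetric in `s` and `t`.
coprime⇒∣pred : ∀ {p} y .{{_ : NonZero y}} {s t} → Coprime s t →
  p ∣ pred (y ^ s) → p ∣ pred (y ^ t) → p ∣ pred y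
coprime⇒∣pred y cop ps pt with coprime-Bézout cop
... | Bézout.+- u v eq = bézout⇒∣pred y u v eq ps pt
... | Bézout.-+ u v eq = bézout⇒∣pred y v u eq pt ps

-- Coprimality and prime divisors.

coprime-* : ∀ {m n o} → Coprime m o → Coprime n o → Coprime (m * n) o
coprime-* m⊥o n⊥o (d∣mn , d∣o) = n⊥o
  (coprime-divisor (λ (e∣d , e∣m) → m⊥o (e∣m , ∣-trans e∣d d∣o)) d∣mn , d∣o)

coprime-^ : ∀ {m n} k → Coprime m n → Coprime (m ^ k) n
coprime-^ {n = n} zero    m⊥n = Coprimality.1-coprimeTo n
coprime-^ (suc k) m⊥n = coprime-* m⊥n (coprime-^ k m⊥n)

prime∣^⇒∣ : ∀ {p a} k → Prime p → p ∣ a ^ k → p ∣ a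
prime∣^⇒∣ {p} zero pr p∣1 = contradiction (subst Prime (∣1⇒≡1 p∣1) pr) ¬prime[1]
prime∣^⇒∣ {a = a} (suc k) pr p∣ with euclidsLemma a (a ^ k) pr p∣
... | inj₁ p∣a  = p∣a
... | inj₂ p∣aᵏ = prime∣^⇒∣ k pr p∣aᵏ

prime∤⇒coprime : ∀ {p n} → Prime p → p ∤ n → Coprime p n
prime∤⇒coprime pr p∤n (d∣p , d∣n) with prime⇒irreducible pr d∣p
... | inj₁ d≡1  = d≡1
... | inj₂ refl = contradiction d∣n p∤n

∃-primeDivisor : ∀ {n} → 1 < n → ∃[ p ] Prime p × p ∣ n
∃-primeDivisor {n} 1<n with factorise n {{>-nonZero (<-trans z<s 1<n)}}
... | record { factors = [] ; isFactorisation = eq } = contradiction eq (>⇒≢ 1<n)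
... | record { factors = p ∷ ps ; isFactorisation = eq ; factorsPrime = pr ∷ _ } =
  p , pr , subst (p ∣_) (sym eq) (m∣m*n (product ps))

-- Finite products, the gcd of cofactors, and powers.

∏ : ℕ → (ℕ → ℕ) → ℕ
∏ zero    f = 1
∏ (suc k) f = ∏ k f * f k

∏≤^ : ∀ {f b} k → (∀ {i} → i < k → f i ≤ b) → ∏ k f ≤ b ^ k
∏≤^ zero h = ≤-refl
∏≤^ {f} {b} (suc k) h = ≤-trans (*-mono-≤ (∏≤^ k (h ∘ m<n⇒m<1+n)) (h ≤-refl)) (≤-reflexive (*-comm (b ^ k) b))

∏-nonZero : ∀ {f} k → (∀ {i} → i < k → NonZero (f i)) → NonZero (∏ k f)
∏-nonZero zero h = _
∏-nonZero {f} (suc k) h = m*n≢0 (∏ k f) (f k) {{∏-nonZero k (h ∘ m<n⇒m<1+n)}} {{h ≤-refl}}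

-- D is the gcd of A and all G i, so A / D is the lcm of the B i.
gcd-cofactors : ∀ {A} (B G : ℕ → ℕ) k → (∀ {i} → i < k → A ≡ B i * G i) →
  ∃[ D ] (∀ {i} → i < k → D ∣ G i) × D ∣ A × A ∣ ∏ k B * D
gcd-cofactors {A} B G zero h = A , (λ ()) , ∣-refl , ∣-reflexive (sym (*-identityˡ A))
gcd-cofactors {A} B G (suc k) h with gcd-cofactors B G k (h ∘ m<n⇒m<1+n)
... | D , D∣G , D∣A , A∣ = gcd D (G k) , D′∣G , ∣-trans (gcd[m,n]∣m D (G k)) D∣A ,
  subst (A ∣_) (sym (c*gcd[m,n]≡gcd[cm,cn] (∏ k B * B k) D (G k)))
    (gcd-greatest
      (subst (A ∣_) (lem (∏ k B) D (B k)) (∣m⇒∣m*n (B k) A∣))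
      (subst (A ∣_) (sym (*-assoc (∏ k B) (B k) (G k))) (∣n⇒∣m*n (∏ k B) (∣-reflexive (h ≤-refl)))))
  where
  lem : ∀ P D b → P * D * b ≡ P * b * D
  lem = solve-∀
  D′∣G : ∀ {i} → i < suc k → gcd D (G k) ∣ G i
  D′∣G i<1+k with m≤n⇒m<n∨m≡n (s≤s⁻¹ i<1+k)
  ... | inj₁ i<k  = ∣-trans (gcd[m,n]∣m D (G k)) (D∣G i<k)
  ... | inj₂ refl = gcd[m,n]∣n D (G k)

n<2^n : ∀ n → n < 2 ^ n
n<2^n zero = z<s
n<2^n (suc n) = ≤-<-trans (≤-reflexive (+-comm 1 n)) (≤-trans (+-mono-<-≤ (n<2^n n) (m^n>0 2 n))
  (≤-reflexive (cong (2 ^ n +_) (sym (+-identityʳ (2 ^ n))))))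

^-distribʳ-* : ∀ a b k → (a * b) ^ k ≡ a ^ k * b ^ k
^-distribʳ-* a b zero = refl
^-distribʳ-* a b (suc k) = trans (cong (a * b *_) (^-distribʳ-* a b k)) (lem a b (a ^ k) (b ^ k))
  where
  lem : ∀ a b c d → a * b * (c * d) ≡ a * c * (b * d)
  lem = solve-∀

-- Construction of the prime.

module PrimeConstruction (K : ℕ) where

  -- A factorial serves twice: each base j divides `x`, and a prime not dividing `x` must exceed
  -- `3 + K`. The offset 3 keeps `3 ≤ x` even when `K` is 0.
  x : ℕ
  x = (3 + K) !

  ∣x : ∀ {j} .{{_ : NonZero j}} → j ≤ 3 + K → j ∣ x
  ∣x {suc j} j≤ = ∣-trans (m∣m*n (j !)) (m≤n⇒m!∣n! j≤)

  instance
    x≢0 : NonZero x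
    x≢0 = (3 + K) !≢0

  3≤x : 3 ≤ x
  3≤x = ≤-trans (m≤m+n 3 K) (∣⇒≤ (∣x ≤-refl))

  -- The factor 2 contributes 2^K, at least K + 1, which beats the number `K` of factors `B i` in
  -- the size estimate.
  n : ℕ
  n = (2 * x) ^ K

  -- Index `i` stands for j = i + 2. For `i < K` the division is exact, so this is n / j^K.
  e : ℕ → ℕ
  e i = (2 * (x / 2+ i)) ^ K

  A : ℕ
  A = pred (x ^ n)

  B G : ℕ → ℕ
  B i = pred (x ^ e i)
  G i = geometric (B i) (2+ i ^ K)

  suc-A : suc A ≡ x ^ n
  suc-A = suc-pred (x ^ n) {{m^n≢0 x n}}

  suc-B : ∀ i → suc (B i) ≡ x ^ e i
  suc-B i = suc-pred (x ^ e i) {{m^n≢0 x (e i)}}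

  2+i∣x : ∀ {i} → i < K → 2+ i ∣ x
  2+i∣x i<K = ∣x (m≤n⇒m≤1+n (s≤s (m≤n⇒m≤1+n i<K)))

  e*j^K≡n : ∀ {i} → i < K → e i * 2+ i ^ K ≡ n
  e*j^K≡n {i} i<K = begin
    (2 * q) ^ K * 2+ i ^ K  ≡⟨ ^-distribʳ-* (2 * q) (2+ i) K ⟨
    (2 * q * 2+ i) ^ K      ≡⟨ cong (_^ K) (*-assoc 2 q (2+ i)) ⟩
    (2 * (q * 2+ i)) ^ K    ≡⟨ cong (λ t → (2 * t) ^ K) (m/n*n≡m (2+i∣x i<K)) ⟩
    n                       ∎
    where
    open ≡-Reasoning
    q = x / 2+ i

  e≤x^K : ∀ {i} → i < K → e i ≤ x ^ K
  e≤x^K {i} i<K = ^-monoˡ-≤ K (begin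
    2 * q     ≡⟨ *-comm 2 q ⟩
    q * 2     ≤⟨ *-monoʳ-≤ q (s≤s (s≤s z≤n)) ⟩
    q * 2+ i  ≡⟨ m/n*n≡m (2+i∣x i<K) ⟩
    x         ∎)
    where
    open ≤-Reasoning
    q = x / 2+ i

  x^e^j^K≡x^n : ∀ {i} → i < K → (x ^ e i) ^ (2+ i ^ K) ≡ x ^ n
  x^e^j^K≡x^n {i} i<K = trans (^-*-assoc x (e i) (2+ i ^ K)) (cong (x ^_) (e*j^K≡n i<K))

  A≡B*G : ∀ {i} → i < K → A ≡ B i * G i
  A≡B*G {i} i<K = suc-injective (begin
    suc A                      ≡⟨ suc-A ⟩
    x ^ n                      ≡⟨ x^e^j^K≡x^n i<K ⟨
    (x ^ e i) ^ (2+ i ^ K)     ≡⟨ cong (_^ (2+ i ^ K)) (suc-B i) ⟨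
    suc (B i) ^ (2+ i ^ K)     ≡⟨ suc^≡1+*geometric (B i) (2+ i ^ K) ⟩
    suc (B i * G i)            ∎)
    where open ≡-Reasoning

  -- Each `B i` is below x^(x^K), so the product is at most `X` = x^(K x^K), while `n` exceeds that
  -- exponent by at least 1; the spare factor `x ≥ 3` leaves room for strictness. Successors are
  -- compared because `A` is a predecessor.
  ∏B<A : ∏ K B < A
  ∏B<A = s<s⁻¹ (begin-strict
    suc (∏ K B)         ≤⟨ s≤s (∏≤^ K (λ {i} i<K → ≤-trans pred[n]≤n (^-monoʳ-≤ x (e≤x^K i<K)))) ⟩
    1 + X               ≤⟨ +-monoˡ-≤ X X>0 ⟩
    X + X               <⟨ +-monoʳ-< X (m<m+n X (≤-trans X>0 (m≤m+n X 0))) ⟩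
    3 * X               ≤⟨ *-monoˡ-≤ X 3≤x ⟩
    x * X               ≡⟨ cong (x *_) (^-*-assoc x (x ^ K) K) ⟩
    x ^ (1 + x ^ K * K) ≤⟨ ^-monoʳ-≤ x 1+x^K*K≤n ⟩
    x ^ n               ≡⟨ suc-A ⟨
    suc A               ∎)
    where
    open ≤-Reasoning
    X = (x ^ (x ^ K)) ^ K
    X>0 : 0 < X
    X>0 = m^n>0 _ {{m^n≢0 x (x ^ K)}} K
    1+x^K*K≤n : 1 + x ^ K * K ≤ n
    1+x^K*K≤n = begin
      1 + x ^ K * K       ≤⟨ +-monoˡ-≤ (x ^ K * K) (m^n>0 x K) ⟩
      x ^ K + x ^ K * K   ≡⟨ *-suc (x ^ K) K ⟨
      x ^ K * suc K       ≤⟨ *-monoʳ-≤ (x ^ K) (n<2^n K) ⟩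
      x ^ K * 2 ^ K       ≡⟨ *-comm (x ^ K) (2 ^ K) ⟩
      2 ^ K * x ^ K       ≡⟨ ^-distribʳ-* 2 x K ⟨
      n                   ∎

  instance
    A≢0 : NonZero A
    A≢0 = >-nonZero (≤-<-trans z≤n ∏B<A)

  private
    cofactors = gcd-cofactors B G K A≡B*G

  D : ℕ
  D = proj₁ cofactors

  D∣G : ∀ {i} → i < K → D ∣ G i
  D∣G = proj₁ (proj₂ cofactors)

  D∣A : D ∣ A
  D∣A = proj₁ (proj₂ (proj₂ cofactors))

  1<D : 1 < D
  1<D = ≰⇒> λ D≤1 → <⇒≱ ∏B<A (begin
    A           ≤⟨ ∣⇒≤ {{m*n≢0 (∏ K B) D {{∏B≢0}} {{D≢0}}}} (proj₂ (proj₂ (proj₂ cofactors))) ⟩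
    ∏ K B * D   ≤⟨ *-monoʳ-≤ (∏ K B) D≤1 ⟩
    ∏ K B * 1   ≡⟨ *-identityʳ (∏ K B) ⟩
    ∏ K B       ∎)
    where
    open ≤-Reasoning
    D≢0 : NonZero D
    D≢0 = ≢-nonZero λ D≡0 → ≢-nonZero⁻¹ A (0∣⇒≡0 (subst (_∣ A) D≡0 D∣A))
    ∏B≢0 : NonZero (∏ K B)
    ∏B≢0 = ∏-nonZero K λ {i} i<K → m*n≢0⇒m≢0 (B i) {{subst NonZero (A≡B*G i<K) A≢0}}

  module _ {p} (pr : Prime p) (p∣D : p ∣ D) where

    p∣A : p ∣ A
    p∣A = ∣-trans p∣D D∣A

    -- Otherwise `p` divides both `A` and `suc A`, the latter being a power of `x` with positive
    -- exponent.
    p∤x : p ∤ x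
    p∤x p∣x = ¬prime[1] (subst Prime (∣1⇒≡1 (∣m+n∣m⇒∣n
      (subst (p ∣_) (trans (sym suc-A) (+-comm 1 A)) (p∣x^ n {{m^n≢0 (2 * x) K {{m*n≢0 2 x}}}})) p∣A)) pr)
      where
      p∣x^ : ∀ k .{{_ : NonZero k}} → p ∣ x ^ k
      p∣x^ (suc k) = ∣m⇒∣m*n (x ^ k) p∣x

    3+K<p : 3 + K < p
    3+K<p = ≰⇒> λ p≤ → p∤x (∣x {{prime⇒nonZero pr}} p≤)

    -- If j = i + 2 were coprime to p - 1, then x^(e i), whose powers with exponents j^K and p - 1
    -- are both 1 modulo `p`, would itself be 1. So `p ∣ B i`; as also `p ∣ G i`, `p` divides j^K
    -- and hence j, yet j < p.
    ¬coprime : ∀ {i} → i < K → ¬ Coprime (2+ i) (pred p)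
    ¬coprime {i} i<K cop = <⇒≱ 3+K<p (begin
      p      ≤⟨ ∣⇒≤ (prime∣^⇒∣ K pr (∣geometric⇒∣ (2+ i ^ K) p∣B (∣-trans p∣D (D∣G i<K)))) ⟩
      2+ i   ≤⟨ s≤s (m≤n⇒m≤1+n i<K) ⟩
      2+ K   ≤⟨ n≤1+n _ ⟩
      3 + K  ∎)
      where
      open ≤-Reasoning
      p∣B : p ∣ B i
      p∣B = coprime⇒∣pred (x ^ e i) {{m^n≢0 x (e i)}} (coprime-^ K cop)
        (subst (λ z → p ∣ pred z) (sym (x^e^j^K≡x^n i<K)) p∣A)
        (fermat pr (p∤x ∘ prime∣^⇒∣ (e i) pr))

∃-prime-noncoprimes : ∀ K → ∃[ p ] Prime p × K < p × (∀ {j} → 2 ≤ j → j ≤ K → ¬ Coprime j (pred p))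
∃-prime-noncoprimes K = conclude (∃-primeDivisor 1<D)
  where
  open PrimeConstruction K
  conclude : ∃[ p ] Prime p × p ∣ D → ∃[ p ] Prime p × K < p × (∀ {j} → 2 ≤ j → j ≤ K → ¬ Coprime j (pred p))
  conclude (p , pr , p∣D) = p , pr , ≤-<-trans (m≤n+m K 3) (3+K<p pr p∣D) ,
    λ { {2+ i} _ j≤K → ¬coprime pr p∣D (≤-trans (n≤1+n _) j≤K) ; {1} (s≤s ()) _ }

-- Locating a prime factor of a totient value at a prime power.

splitPrimePower : ∀ {q} → Prime q → ∀ x → 1 ≤ x → ∃[ α ] ∃[ y ] x ≡ q ^ α * y × q ∤ y
splitPrimePower {q} pr = <-rec _ go
  where
  instance
    _ = prime⇒nonTrivial pr
  go : ∀ x → (∀ {x′} → x′ < x → 1 ≤ x′ → ∃[ α ] ∃[ y ] x′ ≡ q ^ α * y × q ∤ y) →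
       1 ≤ x → ∃[ α ] ∃[ y ] x ≡ q ^ α * y × q ∤ y
  go x rec 1≤x with q ∣? x
  ... | no q∤x = 0 , x , sym (*-identityˡ x) , q∤x
  ... | yes q∣x with rec (quotient-< q∣x {{it}} {{>-nonZero 1≤x}}) (>-nonZero⁻¹ _ {{quotient≢0 q∣x {{>-nonZero 1≤x}}}})
  ... | α , y , eq , q∤y = suc α , y ,
    trans (m∣n⇒n≡m*quotient q∣x) (trans (cong (q *_) eq) (sym (*-assoc q (q ^ α) y))) , q∤y

open IsSchemmelTotient

-- Multiplicativity splits `S x` along the full power of one prime factor of `x`; Euclid's lemma
-- puts `p` in that factor or in the smaller cofactor, where the induction continues. Divisibility
-- of `S x` is kept because it later yields `q ∸ r ∣ p * m`.
prime∣S⇒primePower : ∀ {r S p} → IsSchemmelTotient r S → Prime p → ∀ x → 1 ≤ x → p ∣ S x →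
  ∃[ q ] ∃[ α ] Prime q × S (q ^ suc α) ∣ S x × p ∣ S (q ^ suc α)
prime∣S⇒primePower {r} {S} {p} isS pr = <-rec _ go
  where
  go : ∀ x → (∀ {y} → y < x → 1 ≤ y → p ∣ S y → ∃[ q ] ∃[ α ] Prime q × S (q ^ suc α) ∣ S y × p ∣ S (q ^ suc α)) →
       1 ≤ x → p ∣ S x → ∃[ q ] ∃[ α ] Prime q × S (q ^ suc α) ∣ S x × p ∣ S (q ^ suc α)
  go 1 rec _ p∣ = contradiction (subst Prime (∣1⇒≡1 (subst (p ∣_) (one isS) p∣)) pr) ¬prime[1]
  go x@(2+ _) rec 1≤x p∣Sx with ∃-primeDivisor {x} (s≤s (s≤s z≤n))
  ... | q , prq , q∣x with splitPrimePower prq x 1≤x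
  ... | zero , y , eq , q∤y = contradiction (subst (q ∣_) (trans eq (*-identityˡ y)) q∣x) q∤y
  ... | suc α , y , eq , q∤y = conclude (euclidsLemma (S (q ^ suc α)) (S y) pr (subst (p ∣_) Sx≡ p∣Sx))
    where
    instance
      _ = prime⇒nonTrivial prq
      _ = prime⇒nonZero prq
    1≤y : 1 ≤ y
    1≤y = n≢0⇒n>0 λ { refl → q∤y (q ∣0) }
    1<qα : 1 < q ^ suc α
    1<qα = *-mono-≤ (nonTrivial⇒n>1 q) (m^n>0 q α)
    y<x : y < x
    y<x = subst (y <_) (trans (*-comm y _) (sym eq)) (m<m*n y (q ^ suc α) {{>-nonZero 1≤y}} 1<qα)
    Sx≡ : S x ≡ S (q ^ suc α) * S y
    Sx≡ = trans (cong S eq) (multiplicative isS _ y (<⇒≤ 1<qα) 1≤y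
      (coprime-^ (suc α) (prime∤⇒coprime prq q∤y)))
    conclude : p ∣ S (q ^ suc α) ⊎ p ∣ S y → _
    conclude (inj₁ p∣) = q , α , prq , subst (S (q ^ suc α) ∣_) (sym Sx≡) (m∣m*n (S y)) , p∣
    conclude (inj₂ p∣) with rec y<x 1≤y p∣
    ... | q′ , α′ , prq′ , S∣ , p∣′ = q′ , α′ , prq′ , subst (S (q′ ^ suc α′) ∣_) (sym Sx≡) (∣n⇒∣m*n (S (q ^ suc α)) S∣) , p∣′

-- Excluding the value `p * m`.

regroup : ∀ d p r → d + p * d + r ≡ d + r + d * p
regroup = solve-∀

nontotient : ∀ {r m S p} → 1 ≤ r → 1 ≤ m → IsSchemmelTotient r S → Prime p → m + r < p →
  (∀ {j} → 2 ≤ j → j ≤ m + r → ¬ Coprime j (pred p)) → SchemmelNontotient S (p * m)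
nontotient {r} {m} {S} {p} 1≤r 1≤m isS pr m+r<p ¬cop = *-mono-≤ 1≤p 1≤m , impossible
  where
  instance
    p≢0 = prime⇒nonZero pr
    m≢0 = >-nonZero 1≤m
  1≤p : 1 ≤ p
  1≤p = >-nonZero⁻¹ p

  -- The case q = p: as 0 < p - r < p, `p ∸ r` is coprime to `p` and so divides `m`, giving p ≤ m +
  -- r.
  square-case : p > r → p ∸ r ∣ p * m → ⊥
  square-case p>r p-r∣pm = <⇒≱ m+r<p (begin
    p            ≡⟨ m∸n+n≡m (<⇒≤ p>r) ⟨
    p ∸ r + r    ≤⟨ +-monoˡ-≤ r (∣⇒≤ (coprime-divisor (Coprimality.sym p⊥p-r) p-r∣pm)) ⟩
    m + r        ∎)
    where
    open ≤-Reasoning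
    p⊥p-r : Coprime p (p ∸ r)
    p⊥p-r = Coprimality.prime⇒coprime pr {{>-nonZero (m<n⇒0<n∸m p>r)}} (∸-monoʳ-< 1≤r (<⇒≤ p>r))

  linear-case : ∀ {q} → Prime q → q > r → p ∣ q ∸ r → q ∸ r ∣ p * m → ⊥
  linear-case {q} prq q>r p∣q-r q-r∣pm = conclude (prime⇒irreducible prq g∣q)
    where
    open ≤-Reasoning
    d = quotient p∣q-r
    q-r≡p*d : q ∸ r ≡ p * d
    q-r≡p*d = m∣n⇒n≡m*quotient p∣q-r
    instance
      d≢0 : NonZero d
      d≢0 = quotient≢0 p∣q-r {{>-nonZero (m<n⇒0<n∸m q>r)}}
    -- Cancelling `p` from p d ∣ p m gives d ∣ m, so `d + r` lies in the range of `¬cop`.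
    d≤m : d ≤ m
    d≤m = ∣⇒≤ (*-cancelˡ-∣ p (subst (_∣ p * m) q-r≡p*d q-r∣pm))
    g = gcd (d + r) (pred p)
    -- As p is 1 modulo p - 1, `q` = p d + r is d + r modulo p - 1; this makes `g` a divisor of `q`.
    q≡ : q ≡ d + r + d * pred p
    q≡ = begin-equality
      q                   ≡⟨ m∸n+n≡m (<⇒≤ q>r) ⟨
      q ∸ r + r           ≡⟨ cong (_+ r) q-r≡p*d ⟩
      p * d + r           ≡⟨ cong (λ t → t * d + r) (suc-pred p) ⟨
      d + pred p * d + r  ≡⟨ regroup d (pred p) r ⟩
      d + r + d * pred p  ∎
    g∣q : g ∣ q
    g∣q = subst (g ∣_) (sym q≡) (∣m∣n⇒∣m+n (gcd[m,n]∣m (d + r) (pred p)) (∣n⇒∣m*n d (gcd[m,n]∣n (d + r) (pred p))))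
    0<d*[p-1] : 0 < d * pred p
    0<d*[p-1] = *-mono-≤ (>-nonZero⁻¹ d) (s<s⁻¹ (subst (1 <_) (sym (suc-pred p)) (nonTrivial⇒n>1 p {{prime⇒nonTrivial pr}})))
    conclude : g ≡ 1 ⊎ g ≡ q → ⊥
    conclude (inj₁ g≡1) = ¬cop (+-mono-≤ (>-nonZero⁻¹ d) 1≤r)
      (+-monoˡ-≤ r d≤m) (gcd≡1⇒coprime g≡1)
    -- `g` is at most `d + r`, which `q` exceeds by d (p - 1) > 0.
    conclude (inj₂ g≡q) = <⇒≱ (m<m+n (d + r) 0<d*[p-1]) (begin
      d + r + d * pred p  ≡⟨ q≡ ⟨
      q                   ≡⟨ g≡q ⟨
      g                   ≤⟨ gcd[m,n]≤m ⟩
      d + r               ∎)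
      where
      gcd[m,n]≤m = ∣⇒≤ {{>-nonZero (≤-trans 1≤r (m≤n+m r d))}} (gcd[m,n]∣m (d + r) (pred p))

  impossible : ∀ x → 1 ≤ x → S x ≡ p * m → ⊥
  impossible x 1≤x Sx≡pm with prime∣S⇒primePower isS pr x 1≤x (subst (p ∣_) (sym Sx≡pm) (m∣m*n m))
  ... | q , α , prq , S∣Sx , p∣S = byCases (<-≤-connex r q)
    where
    byCases : r < q ⊎ q ≤ r → ⊥
    -- A prime q ≤ r makes `S x` divisible by 0, though `p * m` is positive.
    byCases (inj₂ q≤r) = ≢-nonZero⁻¹ (p * m) {{m*n≢0 p m}}
      (0∣⇒≡0 (subst₂ _∣_ (small-prime isS q α prq q≤r) Sx≡pm S∣Sx))
    byCases (inj₁ q>r) = conclude (euclidsLemma (q ^ α) (q ∸ r) pr (subst (p ∣_) S≡ p∣S))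
      where
      S≡ = large-prime isS q α prq q>r
      q-r∣pm : q ∸ r ∣ p * m
      q-r∣pm = ∣-trans (n∣m*n (q ^ α)) (subst₂ _∣_ S≡ Sx≡pm S∣Sx)
      conclude : p ∣ q ^ α ⊎ p ∣ q ∸ r → ⊥
      conclude (inj₂ p∣q-r) = linear-case prq q>r p∣q-r q-r∣pm
      -- A prime dividing a power of the prime `q` equals `q`; `prime∣^⇒∣` also covers `α` = 0,
      -- where p ∣ 1 is absurd.
      conclude (inj₁ p∣q^α) with prime⇒irreducible prq (prime∣^⇒∣ α pr p∣q^α)
      ... | inj₁ refl = ¬prime[1] pr
      ... | inj₂ refl = square-case q>r q-r∣pm

theorem1p1 : (r m : ℕ) → 1 ≤ r → 1 ≤ m → (S : ℕ → ℕ) → IsSchemmelTotient r S →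
    (N : ℕ) → Σ ℕ (λ p → (p > N) × Prime p × SchemmelNontotient S (p * m))
-- With K = N + (m + r) the single bound K < p gives both p > N and p > m + r, and the range j ≤ K
-- covers j ≤ m + r.
theorem1p1 r m 1≤r 1≤m S isS N = conclude (∃-prime-noncoprimes (N + (m + r)))
  where
  m+r≤K : m + r ≤ N + (m + r)
  m+r≤K = m≤n+m (m + r) N
  conclude : (∃[ p ] Prime p × N + (m + r) < p × (∀ {j} → 2 ≤ j → j ≤ N + (m + r) → ¬ Coprime j (pred p))) →
    ∃[ p ] p > N × Prime p × SchemmelNontotient S (p * m)
  conclude (p , pr , K<p , ¬cop) = p , ≤-<-trans (m≤m+n N (m + r)) K<p , pr ,
    nontotient 1≤r 1≤m isS pr (≤-<-trans m+r≤K K<p) (λ 2≤j j≤m+r → ¬cop 2≤j (≤-trans j≤m+r m+r≤K))
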